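{- For every $n\ge1$, the number of layers on $n$ channels that are in last layer normal form is $P_{n+5}$, where $(P_m)$ is the Padovan sequence defined by $P_0=1$, $P_1=P_2=0$ and $P_{m+3}=P_m+P_{m+1}$.
   Context: Channels are numbered $1,\ldots,n$. A layer on $n$ channels is a set of comparators $(i,j)$ with $1\le i<j\le n$ such that each channel occurs in at most one comparator of the layer. A channel is used in a layer if it occurs in some comparator of that layer. A layer is in last layer normal form if (i) every comparator in it is of the form $(i,i+1)$, and (ii) there is no $i$ with $1\le i<n$ such that both channels $i$ and $i+1$ are unused in the layer. -}

module Defs where

open import Data.Fin.Base using (Fin; toℕ; _<_)
open import Data.Fin.Subset using (Subset) renaming (_∈_ to _∈ˢ_)
open import Data.Nat.Base using (ℕ; suc; _+_)
open import Data.Product.Base using (Σ; ∃; _×_; _,_; proj₁; proj₂)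
open import Data.Sum.Base using (_⊎_)
open import Data.Vec.Base using (Vec; lookup)
open import Level using (0ℓ)
open import Relation.Binary.Bundles using (Setoid)
import Relation.Binary.Construct.On as On
open import Relation.Binary.PropositionalEquality using (_≡_; setoid)
open import Relation.Nullary.Negation using (¬_)

-- Channel k of the usual numbering 1, …, n is the element of Fin n with
-- toℕ equal to k - 1.
Channel : ℕ → Set
Channel = Fin

Pair : ℕ → Set
Pair n = Channel n × Channel n

IsComparator : ∀ {n} → Pair n → Set
IsComparator (i , j) = i < j

-- A finite set of pairs of channels, stored as one subset per first
-- component, so that propositional equality is equality of sets.
PairSet : ℕ → Set
PairSet n = Vec (Subset n) n

infix 4 _∈_

_∈_ : ∀ {n} → Pair n → PairSet n → Set
(i , j) ∈ S = j ∈ˢ lookup S i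

_OccursIn_ : ∀ {n} → Channel n → Pair n → Set
k OccursIn (i , j) = k ≡ i ⊎ k ≡ j

record Layer (n : ℕ) : Set where
  field
    comparators  : PairSet n
    isComparator : ∀ c → c ∈ comparators → IsComparator c
    atMostOne    : ∀ k c d → c ∈ comparators → d ∈ comparators →
                   k OccursIn c → k OccursIn d → c ≡ d

open Layer public

Used : ∀ {n} → Layer n → Channel n → Set
Used L k = ∃ λ c → c ∈ comparators L × k OccursIn c

Adjacent : ∀ {n} → Channel n → Channel n → Set
Adjacent i j = toℕ j ≡ suc (toℕ i)

record LastLayerNormalForm {n : ℕ} (L : Layer n) : Set where
  field
    adjacentOnly     : ∀ i j → (i , j) ∈ comparators L → Adjacent i j
    noAdjacentUnused : ∀ i j → Adjacent i j → ¬ (¬ Used L i × ¬ Used L j)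

-- Layers are compared by their comparator sets only: the proofs carried
-- by a layer must not contribute to the count.
normalFormLayers : ℕ → Setoid 0ℓ 0ℓ
normalFormLayers n =
  On.setoid {B = Σ (Layer n) LastLayerNormalForm}
            (setoid (PairSet n)) (λ L → comparators (proj₁ L))

padovan : ℕ → ℕ
padovan 0 = 1
padovan 1 = 0
padovan 2 = 0
padovan (suc (suc (suc m))) = padovan m + padovan (suc m)

{-# OPTIONS --safe #-}
-- A layer in last layer normal form is determined by the set of channels i
-- at which a comparator (i , i+1) starts.  These sets correspond to the tilings
-- of a row of n channels by comparators and unused channels in which no two
-- unused channels are neighbours.  Such a tiling of a row of length n + 3 starts
-- with a comparator, or with an unused channel followed by a comparator, which
-- is the Padovan recursion.
module Submission where

open import Defs
open import Data.Empty using (⊥-elim)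
open import Data.Fin.Base using (Fin; zero; suc; toℕ)
open import Data.Fin.Properties using (toℕ-injective; +↔⊎)
open import Data.Fin.Subset using (Subset; inside; outside; _⊆_)
  renaming (_∈_ to _∈ˢ_; _∉_ to _∉ˢ_)
open import Data.Fin.Subset.Properties using (_∈?_; nonempty?; ⊆-antisym; drop-there)
open import Data.Nat.Base using (ℕ; suc; _+_; _≥_)
import Data.Nat.Properties as ℕ
open import Data.Product.Base using (∃; _×_; _,_; proj₁; proj₂)
open import Data.Sum.Base using (_⊎_; inj₁; inj₂)
open import Data.Sum.Function.Propositional using (_⊎-↔_)
open import Data.Vec.Base using (Vec; []; _∷_; here; there; lookup; tabulate)
open import Data.Vec.Properties
  using (lookup∘tabulate; tabulate∘lookup; tabulate-cong; lookup⇒[]=; []=⇒lookup; ∷-injectiveʳ)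
open import Function.Base using (_∘_)
open import Function.Bundles using (Inverse; _↔_; mk↔ₛ′)
import Function.Construct.Composition as Composition
open import Function.Properties.Inverse using (↔-sym; ↔-trans)
open import Relation.Binary.Bundles using (Setoid)
open import Relation.Binary.PropositionalEquality
  using (_≡_; refl; sym; trans; cong; subst; setoid)
open import Relation.Nullary.Decidable using (Dec; does; yes; _×-dec_; dec-true)
open import Relation.Nullary.Negation using (¬_)

private variable
  n : ℕ

-- Decidable subsets, extensionality of vectors, and uniqueness of neighbours.

separate : {P : Fin n → Set} → (∀ i → Dec (P i)) → Subset n
separate P? = tabulate (does ∘ P?)

module _ {P : Fin n → Set} (P? : ∀ i → Dec (P i)) where

  ∈-separate⁺ : ∀ {i} → P i → i ∈ˢ separate P?
  ∈-separate⁺ {i} p =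
    lookup⇒[]= i _ (trans (lookup∘tabulate (does ∘ P?) i) (dec-true (P? i) p))

  ∈-separate⁻ : ∀ {i} → i ∈ˢ separate P? → P i
  ∈-separate⁻ {i} i∈
    with P? i | trans (sym (lookup∘tabulate (does ∘ P?) i)) ([]=⇒lookup i∈)
  ... | yes p | _ = p

lookup-ext : {A : Set} {xs ys : Vec A n} → (∀ i → lookup xs i ≡ lookup ys i) → xs ≡ ys
lookup-ext {xs = xs} {ys} eq =
  trans (sym (tabulate∘lookup xs)) (trans (tabulate-cong eq) (tabulate∘lookup ys))

Adjacent-uniqueʳ : {i j k : Channel n} → Adjacent i j → Adjacent i k → j ≡ k
Adjacent-uniqueʳ p q = toℕ-injective (trans p (sym q))

Adjacent-uniqueˡ : {i j k : Channel n} → Adjacent i k → Adjacent j k → i ≡ j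
Adjacent-uniqueˡ p q = toℕ-injective (ℕ.suc-injective (trans (sym p) q))

Adjacent-irrefl : {i : Channel n} → ¬ Adjacent i i
Adjacent-irrefl p = ℕ.1+n≢n (sym p)

-- Comparator sets and their start sets.

starts : PairSet n → Subset n
starts S = separate (λ i → nonempty? (lookup S i))

adjacentFrom? : (m : Subset n) (i j : Channel n) → Dec (i ∈ˢ m × Adjacent i j)
adjacentFrom? m i j = (i ∈? m) ×-dec (toℕ j ℕ.≟ suc (toℕ i))

adjacentPairs : Subset n → PairSet n
adjacentPairs m = tabulate (λ i → separate (adjacentFrom? m i))

module _ (S : PairSet n) where

  ∈-starts⁺ : ∀ {i j} → (i , j) ∈ S → i ∈ˢ starts S
  ∈-starts⁺ ij∈ = ∈-separate⁺ (λ i → nonempty? (lookup S i)) (_ , ij∈)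

  ∈-starts⁻ : ∀ {i} → i ∈ˢ starts S → ∃ λ j → (i , j) ∈ S
  ∈-starts⁻ = ∈-separate⁻ (λ i → nonempty? (lookup S i))

module _ (m : Subset n) where

  ∈-adjacentPairs⁺ : ∀ {i j} → i ∈ˢ m → Adjacent i j → (i , j) ∈ adjacentPairs m
  ∈-adjacentPairs⁺ {i} {j} i∈ adj =
    subst (j ∈ˢ_) (sym (lookup∘tabulate (λ i → separate (adjacentFrom? m i)) i))
      (∈-separate⁺ (adjacentFrom? m i) (i∈ , adj))

  ∈-adjacentPairs⁻ : ∀ {i j} → (i , j) ∈ adjacentPairs m → i ∈ˢ m × Adjacent i j
  ∈-adjacentPairs⁻ {i} {j} ij∈ =
    ∈-separate⁻ (adjacentFrom? m i)
      (subst (j ∈ˢ_) (lookup∘tabulate (λ i → separate (adjacentFrom? m i)) i) ij∈)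

-- The layer conditions, read off from the starts alone. Channel `i` is used exactly when it or its
-- predecessor is a start; for `j` the predecessor is `i`, so `noGap` has to mention only the
-- predecessor of `i`. Quantifying over all `h` adjacent to `i` makes that clause vacuous when `i`
-- is the first channel.
record NormalStarts {n : ℕ} (m : Subset n) : Set where
  field
    hasNext  : ∀ {i} → i ∈ˢ m → ∃ λ j → Adjacent i j
    disjoint : ∀ {i j} → Adjacent i j → i ∈ˢ m → j ∉ˢ m
    noGap    : ∀ {i j} → Adjacent i j → i ∉ˢ m → j ∉ˢ m →
               ¬ (∀ {h} → Adjacent h i → h ∉ˢ m)

open NormalStarts

module _ {L : Layer n} (nf : LastLayerNormalForm L) where
  open LastLayerNormalForm nf

  private
    S = comparators L

  starts-normal : NormalStarts (starts S)
  starts-normal .hasNext i∈ with ∈-starts⁻ S i∈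
  ... | j , ij∈ = j , adjacentOnly _ j ij∈
  starts-normal .disjoint {i} adj i∈ j∈ with ∈-starts⁻ S i∈ | ∈-starts⁻ S j∈
  ... | j′ , ij′∈ | k , jk∈ with Adjacent-uniqueʳ adj (adjacentOnly _ j′ ij′∈)
  -- Two neighbouring starts would put `j′` into both `(i , j′)` and `(j′ , k)`; identifying these
  -- comparators makes `i` adjacent to itself.
  ... | refl with atMostOne L j′ (i , j′) (j′ , k) ij′∈ jk∈ (inj₂ refl) (inj₁ refl)
  ... | refl = Adjacent-irrefl adj
  starts-normal .noGap {i} {j} adj i∉ j∉ pred∉ = noAdjacentUnused i j adj (unusedˡ , unusedʳ)
    where
    unusedˡ : ¬ Used L i
    unusedˡ (_ , c∈ , inj₁ refl) = i∉ (∈-starts⁺ S c∈)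
    unusedˡ (_ , c∈ , inj₂ refl) = pred∉ (adjacentOnly _ _ c∈) (∈-starts⁺ S c∈)

    unusedʳ : ¬ Used L j
    unusedʳ (_ , c∈ , inj₁ refl) = j∉ (∈-starts⁺ S c∈)
    unusedʳ ((a , _) , c∈ , inj₂ refl) =
      i∉ (subst (_∈ˢ starts S) (Adjacent-uniqueˡ (adjacentOnly a j c∈) adj) (∈-starts⁺ S c∈))

  -- In normal form the only possible partner of a first channel is its successor, so each row of
  -- `S` is recovered from whether it is nonempty.
  adjacentPairs-starts : adjacentPairs (starts S) ≡ S
  adjacentPairs-starts = lookup-ext λ i → ⊆-antisym (to-S i) (from-S i)
    where
    to-S : ∀ i → lookup (adjacentPairs (starts S)) i ⊆ lookup S i
    to-S i ij∈ with ∈-adjacentPairs⁻ (starts S) ij∈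
    ... | i∈ , adj with ∈-starts⁻ S i∈
    ... | j′ , ij′∈ = subst (_∈ˢ lookup S i) (Adjacent-uniqueʳ (adjacentOnly i j′ ij′∈) adj) ij′∈

    from-S : ∀ i → lookup S i ⊆ lookup (adjacentPairs (starts S)) i
    from-S i {j} ij∈ = ∈-adjacentPairs⁺ (starts S) (∈-starts⁺ S ij∈) (adjacentOnly i j ij∈)

module _ {m : Subset n} (normal : NormalStarts m) where

  -- The inclusion from `m` rests on `hasNext`: a start at the last channel would have an empty row
  -- in `adjacentPairs m` and be lost.
  starts-adjacentPairs : starts (adjacentPairs m) ≡ m
  starts-adjacentPairs = ⊆-antisym to-m from-m
    where
    to-m : starts (adjacentPairs m) ⊆ m
    to-m i∈ = proj₁ (∈-adjacentPairs⁻ m (proj₂ (∈-starts⁻ (adjacentPairs m) i∈)))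

    from-m : m ⊆ starts (adjacentPairs m)
    from-m i∈ = ∈-starts⁺ (adjacentPairs m) (∈-adjacentPairs⁺ m i∈ (proj₂ (hasNext normal i∈)))

  layer : Layer n
  layer .comparators = adjacentPairs m
  layer .isComparator _ c∈ = ℕ.≤-reflexive (sym (proj₂ (∈-adjacentPairs⁻ m c∈)))
  layer .atMostOne k c d c∈ d∈ k∈c k∈d
    with ∈-adjacentPairs⁻ m c∈ | ∈-adjacentPairs⁻ m d∈ | k∈c | k∈d
  ... | _ , p | _ , q | inj₁ refl | inj₁ refl = cong (k ,_) (Adjacent-uniqueʳ p q)
  -- In the two mixed cases `k` ends one comparator and starts the other, so `k` and its predecessor
  -- would both be starts.
  ... | a , _ | b , q | inj₁ refl | inj₂ refl = ⊥-elim (disjoint normal q b a)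
  ... | a , p | b , _ | inj₂ refl | inj₁ refl = ⊥-elim (disjoint normal p a b)
  ... | _ , p | _ , q | inj₂ refl | inj₂ refl = cong (_, k) (Adjacent-uniqueˡ p q)

  layer-used : ∀ {i} → i ∈ˢ m → Used layer i
  layer-used i∈ = _ , ∈-adjacentPairs⁺ m i∈ (proj₂ (hasNext normal i∈)) , inj₁ refl

  layer-normal : LastLayerNormalForm layer
  layer-normal = record
    { adjacentOnly     = λ _ _ ij∈ → proj₂ (∈-adjacentPairs⁻ m ij∈)
    ; noAdjacentUnused = λ _ _ adj (i-unused , j-unused) →
        noGap normal adj (i-unused ∘ layer-used) (j-unused ∘ layer-used)
          (λ adj′ h∈ → i-unused (_ , ∈-adjacentPairs⁺ m h∈ adj′ , inj₂ refl))
    }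

-- Tilings and their start sets.

data Tiling : ℕ → Set where
  empty            : Tiling 0
  unused           : Tiling 1
  comparator       : Tiling n → Tiling (2 + n)
  unusedComparator : Tiling n → Tiling (3 + n)

tilingStarts : Tiling n → Subset n
tilingStarts empty                = []
tilingStarts unused               = outside ∷ []
tilingStarts (comparator t)       = inside ∷ outside ∷ tilingStarts t
tilingStarts (unusedComparator t) = outside ∷ inside ∷ outside ∷ tilingStarts t

tilingStarts-injective : (t u : Tiling n) → tilingStarts t ≡ tilingStarts u → t ≡ u
tilingStarts-injective empty empty _ = refl
tilingStarts-injective unused unused _ = refl
tilingStarts-injective (comparator t) (comparator u) eq =
  cong comparator (tilingStarts-injective t u (∷-injectiveʳ (∷-injectiveʳ eq)))
tilingStarts-injective (unusedComparator t) (unusedComparator u) eq =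
  cong unusedComparator
    (tilingStarts-injective t u (∷-injectiveʳ (∷-injectiveʳ (∷-injectiveʳ eq))))
tilingStarts-injective (comparator _) (unusedComparator _) ()
tilingStarts-injective (unusedComparator _) (comparator _) ()

-- Normality when tiles are added or removed.

module _ {m : Subset n} where

  comparator-normal : NormalStarts m → NormalStarts (inside ∷ outside ∷ m)
  comparator-normal normal .hasNext here = suc zero , refl
  comparator-normal normal .hasNext (there (there i∈)) with hasNext normal i∈
  ... | j , adj = suc (suc j) , cong (2 +_) adj
  comparator-normal normal .disjoint () here here
  comparator-normal normal .disjoint () here (there (there _))
  comparator-normal normal .disjoint () (there (there _)) here
  comparator-normal normal .disjoint adj (there (there i∈)) (there (there j∈)) =
    disjoint normal (ℕ.+-cancelˡ-≡ 2 _ _ adj) i∈ j∈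
  comparator-normal normal .noGap {zero} adj i∉ _ _ = i∉ here
  -- The second channel is used by the comparator that starts at the first.
  comparator-normal normal .noGap {suc zero} adj _ _ pred∉ = pred∉ refl here
  comparator-normal normal .noGap {suc (suc i)} {suc (suc j)} adj i∉ j∉ pred∉ =
    noGap normal (ℕ.+-cancelˡ-≡ 2 _ _ adj) (i∉ ∘ there ∘ there) (j∉ ∘ there ∘ there)
      (λ adj′ h∈ → pred∉ (cong (2 +_) adj′) (there (there h∈)))

  comparator-normal⁻ : NormalStarts (inside ∷ outside ∷ m) → NormalStarts m
  comparator-normal⁻ normal .hasNext i∈ with hasNext normal (there (there i∈))
  ... | suc (suc j) , adj = j , ℕ.+-cancelˡ-≡ 2 _ _ adj
  comparator-normal⁻ normal .disjoint adj i∈ j∈ =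
    disjoint normal (cong (2 +_) adj) (there (there i∈)) (there (there j∈))
  comparator-normal⁻ normal .noGap adj i∉ j∉ pred∉ =
    noGap normal (cong (2 +_) adj) (i∉ ∘ drop-there ∘ drop-there) (j∉ ∘ drop-there ∘ drop-there)
      -- Removing a whole comparator takes no predecessor away from the tail: the removed start lies
      -- two or more places before every channel that remains.
      λ { () here
        ; adj′ (there (there h∈)) → pred∉ (ℕ.+-cancelˡ-≡ 2 _ _ adj′) h∈ }

  -- The removed channel is not a start, so the new first channel loses no comparator ending at it.
  outside-normal⁻ : NormalStarts (outside ∷ m) → NormalStarts m
  outside-normal⁻ normal .hasNext i∈ with hasNext normal (there i∈)
  ... | suc j , adj = j , ℕ.suc-injective adj
  outside-normal⁻ normal .disjoint adj i∈ j∈ =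
    disjoint normal (cong suc adj) (there i∈) (there j∈)
  outside-normal⁻ normal .noGap adj i∉ j∉ pred∉ =
    noGap normal (cong suc adj) (i∉ ∘ drop-there) (j∉ ∘ drop-there)
      λ { adj′ (there h∈) → pred∉ (ℕ.suc-injective adj′) h∈ }

outside-inside-normal : {m : Subset n} →
  NormalStarts (inside ∷ m) → NormalStarts (outside ∷ inside ∷ m)
outside-inside-normal normal .hasNext (there i∈) with hasNext normal i∈
... | j , adj = suc j , cong suc adj
outside-inside-normal normal .disjoint adj (there i∈) (there j∈) =
  disjoint normal (ℕ.suc-injective adj) i∈ j∈
outside-inside-normal normal .noGap {zero} {suc zero} _ _ j∉ _ = j∉ (there here)
outside-inside-normal normal .noGap {suc i} {suc j} adj i∉ j∉ pred∉ =
  noGap normal (ℕ.suc-injective adj) (i∉ ∘ there) (j∉ ∘ there)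
    (λ adj′ h∈ → pred∉ (cong suc adj′) (there h∈))

tilingStarts-normal : (t : Tiling n) → NormalStarts (tilingStarts t)
tilingStarts-normal empty = record
  { hasNext = λ () ; disjoint = λ _ () ; noGap = λ { {()} } }
tilingStarts-normal unused = record
  { hasNext  = λ { (there ()) }
  ; disjoint = λ { _ (there ()) }
  ; noGap    = λ { {zero} {zero} () }
  }
tilingStarts-normal (comparator t) = comparator-normal (tilingStarts-normal t)
tilingStarts-normal (unusedComparator t) =
  outside-inside-normal (comparator-normal (tilingStarts-normal t))

-- At most three leading entries decide the tile. Each remaining pattern contradicts one field: a
-- start at the end `hasNext`, two neighbouring starts `disjoint`, two leading non-starts `noGap`.
tile : (m : Subset n) → NormalStarts m → ∃ λ t → tilingStarts t ≡ m
tile [] _ = empty , refl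
tile (outside ∷ []) _ = unused , refl
tile (inside ∷ []) normal with hasNext normal here
... | zero , ()
tile (inside ∷ inside ∷ m) normal = ⊥-elim (disjoint normal refl here (there here))
tile (inside ∷ outside ∷ m) normal with tile m (comparator-normal⁻ normal)
... | t , refl = comparator t , refl
tile (outside ∷ outside ∷ m) normal =
  -- The last argument is vacuous, as the first channel has no predecessor.
  ⊥-elim (noGap normal {zero} {suc zero} refl (λ ()) (λ { (there ()) }) (λ ()))
tile (outside ∷ inside ∷ []) normal with hasNext normal (there here)
... | zero , ()
... | suc zero , ()
tile (outside ∷ inside ∷ inside ∷ m) normal =
  ⊥-elim (disjoint normal refl (there here) (there (there here)))
tile (outside ∷ inside ∷ outside ∷ m) normal
  with tile m (comparator-normal⁻ (outside-normal⁻ normal))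
... | t , refl = unusedComparator t , refl

-- The bijection between normal form layers and tilings.

layers↔tilings : ∀ n → Inverse (normalFormLayers n) (setoid (Tiling n))
layers↔tilings n = record
  { to        = to
  ; from      = from
  ; to-cong   = λ {L} {M} → to-cong {L} {M}
  ; from-cong = cong (adjacentPairs ∘ tilingStarts)
  ; inverse   = (λ {t} {L} → inverseˡ {t} {L}) , λ { {L} refl → inverseʳ L }
  }
  where
  open Setoid (normalFormLayers n) using () renaming (Carrier to NormalLayer; _≈_ to _≈ᴸ_)

  tiled : (L : NormalLayer) → ∃ λ t → tilingStarts t ≡ starts (comparators (proj₁ L))
  tiled (_ , nf) = tile _ (starts-normal nf)

  to : NormalLayer → Tiling n
  to L = proj₁ (tiled L)

  from : Tiling n → NormalLayer
  from t = layer (tilingStarts-normal t) , layer-normal (tilingStarts-normal t)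

  to-cong : ∀ {L M} → L ≈ᴸ M → to L ≡ to M
  -- `tile` also takes the proof of normality, but its result is pinned down by its start set, hence
  -- by the comparators alone.
  to-cong {L} {M} L≈M = tilingStarts-injective _ _
    (trans (proj₂ (tiled L)) (trans (cong starts L≈M) (sym (proj₂ (tiled M)))))

  inverseˡ : ∀ {t L} → L ≈ᴸ from t → to L ≡ t
  inverseˡ {t} {L} L≈ = tilingStarts-injective _ _
    (trans (proj₂ (tiled L))
      (trans (cong starts L≈) (starts-adjacentPairs (tilingStarts-normal t))))

  inverseʳ : ∀ L → from (to L) ≈ᴸ L
  inverseʳ L = trans (cong adjacentPairs (proj₂ (tiled L))) (adjacentPairs-starts (proj₂ L))

-- Counting tilings by the Padovan recursion.

oneTiling : ∀ {n} (t : Tiling n) → (∀ u → t ≡ u) → Tiling n ↔ Fin 1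
oneTiling t unique = mk↔ₛ′ (λ _ → zero) (λ _ → t) (λ { zero → refl ; (suc ()) }) unique

splitTiling : ∀ n → Tiling (3 + n) ↔ (Tiling n ⊎ Tiling (suc n))
splitTiling n = mk↔ₛ′ to from (λ { (inj₁ _) → refl ; (inj₂ _) → refl })
  (λ { (comparator _) → refl ; (unusedComparator _) → refl })
  where
  to : Tiling (3 + n) → Tiling n ⊎ Tiling (suc n)
  to (comparator t)       = inj₂ t
  to (unusedComparator t) = inj₁ t

  from : Tiling n ⊎ Tiling (suc n) → Tiling (3 + n)
  from (inj₁ t) = unusedComparator t
  from (inj₂ t) = comparator t

tilings↔Fin : ∀ n → Tiling n ↔ Fin (padovan (n + 5))
-- The shift by 5 fits the base cases: `padovan` takes the value 1 at 5, 6 and 7, and rows of length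
-- 0, 1 and 2 have one tiling each.
tilings↔Fin 0 = oneTiling empty λ { empty → refl }
tilings↔Fin 1 = oneTiling unused λ { unused → refl }
tilings↔Fin 2 = oneTiling (comparator empty) λ { (comparator empty) → refl }
tilings↔Fin (suc (suc (suc n))) =
  -- `padovan (3 + n + 5)` computes to `padovan (n + 5) + padovan (suc n + 5)`; `splitTiling` lists
  -- its summands in the same order.
  ↔-trans (splitTiling n)
    (↔-trans (tilings↔Fin n ⊎-↔ tilings↔Fin (suc n)) (↔-sym +↔⊎))

theorem3 : (n : ℕ) → n ≥ 1 →
    Inverse (normalFormLayers n) (setoid (Fin (padovan (n + 5))))
theorem3 n _ = Composition.inverse (layers↔tilings n) (tilings↔Fin n)
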